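{- Let $B$ be an oriented graph that admits a homomorphism $B \to \vec K_2$. Then the underlying undirected graph $\overline{B}$ (with the bipartition induced by this homomorphism) has the asymmetric Sidorenko property if and only if $B$ has the directed Sidorenko property.
   Context: All graphs are finite with non-empty vertex set. An oriented graph is a directed graph obtained from a simple undirected graph by orienting each edge (so there are no loops and at most one of $(x,y),(y,x)$ is an edge). For a graph or oriented graph $G$, $V(G)$, $E(G)$ are its vertex and edge sets, $v(G)=|V(G)|$, $e(G)=|E(G)|$. $\vec K_2$ is the oriented graph with two vertices and a single directed edge. $\overline{B}$ denotes the undirected graph obtained from the oriented graph $B$ by forgetting the directions of all edges. A homomorphism of oriented graphs $f:V(B)\to V(G)$ is a map such that $(f(x),f(y))\in E(G)$ whenever $(x,y)\in E(B)$. The homomorphism density $t(B,G)$ is the number of homomorphisms from $B$ to $G$ divided by $v(G)^{v(B)}$; in particular $t(\vec K_2,G)=e(G)/v(G)^2$. An oriented graph $B$ has the directed Sidorenko property if for every oriented graph $G$ one has $t(B,G)\ge t(\vec K_2,G)^{e(B)}$. A bipartite undirected graph always comes with a fixed ordered bipartition of its vertex set. If $A$ is bipartite with parts $A_1\sqcup A_2$ and $H$ is bipartite with non-empty parts $U_1\sqcup U_2$, then $t_{\mathrm{bip}}(A,H)$ is the fraction of maps $f:V(A)\to V(H)$ with $f(A_1)\subset U_1$ and $f(A_2)\subset U_2$ that are homomorphisms (i.e. send edges to edges). In particular $t_{\mathrm{bip}}(K_2,H)=|E(H)|/(|U_1||U_2|)$. The graph $A$ has the asymmetric Sidorenko property if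 $t_{\mathrm{bip}}(A,H)\ge t_{\mathrm{bip}}(K_2,H)^{e(A)}$ for all bipartite undirected graphs $H$. If $B$ has a homomorphism to $\vec K_2$, then $\overline{B}$ is regarded as a bipartite graph whose first part is the set of vertices mapped to the tail of the edge of $\vec K_2$ and whose second part is the set of vertices mapped to the head, so that all edges of $B$ are directed from the first part to the second. -}

module Defs where

import Algebra.Definitions.RawSemiring
open import Data.Fin.Base using (Fin; finToFun; funToFin)
open import Data.Fin.Patterns using (0F; 1F)
open import Data.Fin.Properties using (_≟_; _<?_; all?; finToFun-funToFin)
open import Data.Integer.Base using (+_)
open import Data.List.Base
  using (List; length; filter; map; allFin; cartesianProduct)
open import Data.List.Membership.Propositional.Properties using (∈-allFin)
open import Data.List.Properties using (filter-some)
open import Data.List.Relation.Unary.Any as Any using (Any)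
open import Data.List.Relation.Unary.Any.Properties using (map⁺)
open import Data.Nat.Base as ℕ using (ℕ; NonZero; >-nonZero)
open import Data.Nat.Properties using (m^n≢0)
open import Data.Product.Base using (_×_; _,_; ∃-syntax; proj₁; proj₂)
open import Data.Rational.Base using (ℚ; _/_; _≥_; +-*-rawSemiring)
open import Data.Sum.Base using (_⊎_; inj₁; inj₂; swap)
open import Function.Base using (id)
open import Level using (0ℓ)
open import Relation.Binary.Core using (Rel)
open import Relation.Binary.Definitions
  using (Decidable; Symmetric; Asymmetric; Irreflexive)
open import Relation.Binary.PropositionalEquality
  using (_≡_; _≢_; refl; sym; trans; cong; resp₂)
open import Relation.Nullary.Decidable using (_×-dec_; _⊎-dec_; _→-dec_)
open import Relation.Nullary.Negation using (contradiction)
open import Relation.Unary using (Pred) renaming (Decidable to Decidable₁)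

open Algebra.Definitions.RawSemiring +-*-rawSemiring public using (_^_)

private
  variable
    m n : ℕ

record OrientedGraph : Set₁ where
  field
    v        : ℕ
    nonEmpty : NonZero v
    E        : Rel (Fin v) 0ℓ
    E?       : Decidable E
    asym     : Asymmetric E

  V : Set
  V = Fin v

record BipartiteGraph : Set₁ where
  field
    v         : ℕ
    nonEmpty  : NonZero v
    E         : Rel (Fin v) 0ℓ
    E?        : Decidable E
    symmetric : Symmetric E
    irrefl    : Irreflexive _≡_ E
    -- The ordered bipartition: the first part is the fibre over 0F, the
    -- second part the fibre over 1F.  Either may be empty.
    part      : Fin v → Fin 2
    crossing  : ∀ {x y} → E x y → part x ≢ part y

  V : Set
  V = Fin v

NonEmptyParts : BipartiteGraph → Set
NonEmptyParts H = ∀ i → ∃[ u ] BipartiteGraph.part H u ≡ i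

count : {A : Set} {P : Pred A 0ℓ} → Decidable₁ P → List A → ℕ
count P? xs = length (filter P? xs)

pairs : ∀ n → List (Fin n × Fin n)
pairs n = cartesianProduct (allFin n) (allFin n)

-- Each map occurs exactly once, up to pointwise equality.
maps : ∀ m n → List (Fin m → Fin n)
maps m n = map finToFun (allFin (n ℕ.^ m))

IsHom : Rel (Fin m) 0ℓ → Rel (Fin n) 0ℓ → (Fin m → Fin n) → Set
IsHom R S f = ∀ x y → R x y → S (f x) (f y)

isHom? : {R : Rel (Fin m) 0ℓ} {S : Rel (Fin n) 0ℓ} →
         Decidable R → Decidable S → Decidable₁ (IsHom R S)
isHom? R? S? f = all? λ x → all? λ y → R? x y →-dec S? (f x) (f y)

module _ where
  open OrientedGraph

  e : OrientedGraph → ℕ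
  e G = count (λ (x , y) → E? G x y) (pairs (v G))

  Hom : (B G : OrientedGraph) → (V B → V G) → Set
  Hom B G = IsHom (E B) (E G)

  t : OrientedGraph → OrientedGraph → ℚ
  t B G = (+ count (isHom? (E? B) (E? G)) (maps (v B) (v G)))
          / (v G ℕ.^ v B)
    where instance
      _ = nonEmpty G
      _ = m^n≢0 (v G) (v B)

  K⃗₂ : OrientedGraph
  K⃗₂ = record
    { v        = 2
    ; nonEmpty = _
    ; E        = λ x y → x ≡ 0F × y ≡ 1F
    ; E?       = λ x y → x ≟ 0F ×-dec y ≟ 1F
    ; asym     = λ { (refl , refl) (() , _) }
    }

  DirectedSidorenko : OrientedGraph → Set₁
  DirectedSidorenko B = (G : OrientedGraph) → t B G ≥ t K⃗₂ G ^ e B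

  underlying : (B : OrientedGraph) (f : V B → V K⃗₂) → Hom B K⃗₂ f →
               BipartiteGraph
  underlying B f hom = record
    { v         = v B
    ; nonEmpty  = nonEmpty B
    ; E         = λ x y → E B x y ⊎ E B y x
    ; E?        = λ x y → E? B x y ⊎-dec E? B y x
    ; symmetric = swap
    ; irrefl    = λ { refl (inj₁ p) → asym B p p ; refl (inj₂ p) → asym B p p }
    ; part      = f
    ; crossing  = λ { (inj₁ p) eq → apart p eq ; (inj₂ p) eq → apart p (sym eq) }
    }
    where
    apart : ∀ {x y} → E B x y → f x ≢ f y
    apart {x} {y} p eq with hom x y p
    ... | fx≡0 , fy≡1 = contradiction (trans (sym fx≡0) (trans eq fy≡1)) λ ()

module _ where
  open BipartiteGraph

  -- Each edge is counted once, by its increasing pair of endpoints.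
  eBip : BipartiteGraph → ℕ
  eBip A = count (λ (x , y) → x <? y ×-dec E? A x y) (pairs (v A))

  PartPreserving : (A H : BipartiteGraph) → (V A → V H) → Set
  PartPreserving A H f = ∀ x → part H (f x) ≡ part A x

  partPreserving? : ∀ A H → Decidable₁ (PartPreserving A H)
  partPreserving? A H f = all? λ x → part H (f x) ≟ part A x

  #partPreserving : BipartiteGraph → BipartiteGraph → ℕ
  #partPreserving A H = count (partPreserving? A H) (maps (v A) (v H))

  #partPreserving≢0 : ∀ A H → NonEmptyParts H → NonZero (#partPreserving A H)
  #partPreserving≢0 A H ne =
    >-nonZero (filter-some (partPreserving? A H) (map⁺ (Any.map pp (∈-allFin (funToFin g)))))
    where
    g : V A → V H
    g x = proj₁ (ne (part A x))

    pp : ∀ {k} → funToFin g ≡ k → PartPreserving A H (finToFun k)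
    pp refl x = trans (cong (part H) (finToFun-funToFin g x)) (proj₂ (ne (part A x)))

  tBip : (A H : BipartiteGraph) → NonEmptyParts H → ℚ
  tBip A H ne =
    (+ count (λ f → partPreserving? A H f ×-dec isHom? (E? A) (E? H) f)
             (maps (v A) (v H)))
    / #partPreserving A H
    where instance _ = #partPreserving≢0 A H ne

  K₂ : BipartiteGraph
  K₂ = underlying K⃗₂ id (λ _ _ → id)

  AsymmetricSidorenko : BipartiteGraph → Set₁
  AsymmetricSidorenko A =
    (H : BipartiteGraph) (ne : NonEmptyParts H) →
    tBip A H ne ≥ tBip K₂ H ne ^ eBip A

{-# OPTIONS --safe #-}

-- Homomorphism densities in arbitrary digraphs D (loops and opposite arcs
-- allowed) interpolate between the two notions.  The double cover D × K₂ has
-- t_bip(B̄, D × K₂) = t(B, D), and conversely every bipartite H with parts U₁, U₂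
-- has t_bip(B̄, H) = t(B, D) for a digraph D on U₁ × U₂.  So the asymmetric
-- property is the Sidorenko inequality for all digraphs, and it remains to
-- deduce it from the case of oriented graphs: apply that case to D^k × K⃗₂, take
-- k-th roots and let k → ∞.
module Submission where

open import Defs

import Algebra.Properties.CommutativeSemigroup as CommutativeSemigroupProperties
import Data.Nat.Properties as ℕ
import Data.Integer.Base as ℤ
import Data.Integer.Properties as ℤ
import Data.Rational.Base as ℚ
import Data.Rational.Properties as ℚ
import Data.Rational.Unnormalised.Base as ℚᵘ
import Data.Rational.Unnormalised.Properties as ℚᵘ
import Data.List.Relation.Unary.Any as Any
import Data.List.Relation.Unary.All as All
import Data.List.Relation.Unary.Any.Properties as Any
import Data.List.Relation.Unary.Unique.Setoid.Properties as Unique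
import Data.List.Relation.Unary.Enumerates.Setoid.Properties as Enumerates
import Function.Construct.Composition as Composition
import Function.Construct.Identity as Identity
import Function.Construct.Symmetry as Symmetry
import Relation.Binary.Construct.On as On
import Relation.Binary.PropositionalEquality as ≡
open import Data.Fin.Base
  using (Fin; zero; suc; combine; quotient; remainder; opposite;
         finToFun; funToFin; _<_)
open import Data.Fin.Patterns using (0F; 1F)
open import Data.Fin.Permutation using (↔⇒≡)
open import Data.Fin.Properties
  using (_≟_; _<?_; all?; remQuot-combine; combine-remQuot; finToFun-funToFin;
         funToFin-finToFin; *↔×; <-cmp; <-asym)
open import Data.Integer.Base using (+_)
open import Data.List.Base using (List; _∷_; lookup; filter; allFin)
open import Data.List.Membership.Propositional.Properties
  using (∈-allFin; ∈-lookup)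
open import Data.List.Membership.Setoid.Properties using (∈-filter⁺)
open import Data.List.Relation.Unary.All.Properties using (all-filter)
open import Data.List.Relation.Unary.AllPairs using (_∷_)
open import Data.List.Relation.Unary.Enumerates.Setoid using (IsEnumeration)
open import Data.List.Relation.Unary.Unique.Propositional.Properties using (allFin⁺)
open import Data.List.Relation.Unary.Unique.Setoid using (Unique)
open import Data.Nat.Base as ℕ using (ℕ; NonZero; zero; suc)
open import Data.Product.Base using (_×_; _,_; ∃; proj₁; proj₂; swap)
open import Data.Product.Function.NonDependent.Setoid using (_×-inverse_)
open import Data.Product.Relation.Binary.Pointwise.NonDependent
  using (_×ₛ_; Pointwise-≡↔≡)
open import Data.Rational.Base using (ℚ; _/_; _≥_)
open import Data.Rational.Unnormalised.Base using (mkℚᵘ; *≡*; *≤*)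
open import Data.Sum.Base using (inj₁; inj₂)
open import Function.Base using (_∘_; id)
open import Function.Bundles using (_⇔_; Bijection; Inverse; mk⇔)
open import Function.Definitions using (Congruent; StrictlyInverseˡ; StrictlyInverseʳ)
open import Function.Properties.Inverse using (Inverse⇒Bijection)
open import Level using (0ℓ)
open import Relation.Binary.Bundles using (Setoid)
open import Relation.Binary.Core using (Rel)
open import Relation.Binary.Definitions
  using (Decidable; _Respects_; tri<; tri≈; tri>)
open import Relation.Binary.PropositionalEquality
  using (_≡_; refl; sym; trans; cong; cong₂; subst; subst₂; _≗_; _→-setoid_;
         module ≡-Reasoning)
open import Relation.Nullary.Decidable using (yes; no; _×-dec_)
open import Relation.Nullary.Negation using (¬_; contradiction)
open import Relation.Unary using (Pred; _∩_; _⟨×⟩_) renaming (Decidable to Decidable₁)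

private
  variable
    m n : ℕ
    S T : Setoid 0ℓ 0ℓ

open CommutativeSemigroupProperties ℕ.*-commutativeSemigroup
  using (interchange; x∙yz≈y∙xz)

-- Powers of natural numbers

^-distribʳ-* : ∀ m n k → (m ℕ.* n) ℕ.^ k ≡ m ℕ.^ k ℕ.* n ℕ.^ k
^-distribʳ-* m n zero    = refl
^-distribʳ-* m n (suc k) =
  trans (cong (m ℕ.* n ℕ.*_) (^-distribʳ-* m n k)) (interchange m n _ _)

-- A weak Bernoulli inequality, giving linear growth of `suc m ^ suc k` relative to `m ^ k`. In the
-- induction both sides split into one summand plus a multiple: `m ^ suc k` is at most
-- `suc m ^ suc k`, and the rest is `m` times the induction hypothesis.
bernoulli : ∀ m k → suc k ℕ.* m ℕ.^ k ℕ.≤ suc m ℕ.^ suc k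
bernoulli m zero    = ℕ.s≤s ℕ.z≤n
bernoulli m (suc k) = ℕ.+-mono-≤ (ℕ.^-monoˡ-≤ (suc k) (ℕ.n≤1+n m)) (begin
  suc k ℕ.* (m ℕ.* m ℕ.^ k) ≡⟨ x∙yz≈y∙xz (suc k) m _ ⟩
  m ℕ.* (suc k ℕ.* m ℕ.^ k) ≤⟨ ℕ.*-monoʳ-≤ m (bernoulli m k) ⟩
  m ℕ.* suc m ℕ.^ suc k     ∎)
  where open ℕ.≤-Reasoning

-- At `n = 0` the exponent vanishes as well, and `0 ^ 0` is 1. This lets `powers-cancel-≤` cancel a
-- power of `y` without treating `y = 0` separately.
n^[n*k]≢0 : ∀ n k → NonZero (n ℕ.^ (n ℕ.* k))
n^[n*k]≢0 zero    k = _
n^[n*k]≢0 (suc n) k = ℕ.m^n≢0 (suc n) (suc n ℕ.* k)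

-- The limit of `k`-th roots in integer form: if `y < x`, the powers of `x` outgrow those of `y` by
-- more than any constant factor, so fixed `a` and `b` cannot compensate.
powers-cancel-≤ : ∀ {x y a b} .{{_ : NonZero a}} →
                  (∀ k → x ℕ.^ k ℕ.* a ℕ.≤ y ℕ.^ k ℕ.* b) → x ℕ.≤ y
powers-cancel-≤ {x} {y} {a} {b} bound = ℕ.≮⇒≥ λ y<x →
  ℕ.<-irrefl refl (ℕ.*-cancelʳ-≤ (suc k) k (y ℕ.^ k) (begin
    suc k ℕ.* y ℕ.^ k   ≤⟨ bernoulli y k ⟩
    suc y ℕ.^ suc k     ≤⟨ ℕ.^-monoˡ-≤ (suc k) y<x ⟩
    x ℕ.^ suc k         ≤⟨ ℕ.m≤m*n _ a ⟩
    x ℕ.^ suc k ℕ.* a   ≤⟨ bound (suc k) ⟩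
    y ℕ.* y ℕ.^ k ℕ.* b ≡⟨ ℕ.*-assoc y (y ℕ.^ k) b ⟩
    y ℕ.* (y ℕ.^ k ℕ.* b) ≡⟨ x∙yz≈y∙xz y (y ℕ.^ k) b ⟩
    y ℕ.^ k ℕ.* k       ≡⟨ ℕ.*-comm (y ℕ.^ k) k ⟩
    k ℕ.* y ℕ.^ k       ∎))
  where
  open ℕ.≤-Reasoning
  -- With this exponent the upper bound `y ^ suc k * b` equals `k * y ^ k`, just below the lower
  -- bound `suc k * y ^ k`.
  k = y ℕ.* b
  instance _ = n^[n*k]≢0 y b

-- Fractions of natural numbers

-- Since `_/_` reduces to lowest terms, the computations with fractions are transferred to unreduced
-- ones.
toℚᵘ-/ : ∀ a b → ℚ.toℚᵘ (+ a / suc b) ℚᵘ.≃ mkℚᵘ (+ a) b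
toℚᵘ-/ a b = ℚ.toℚᵘ-fromℚᵘ (mkℚᵘ (+ a) b)

/-cross : ∀ a b c d .{{_ : NonZero b}} .{{_ : NonZero d}} →
          a ℕ.* d ≡ c ℕ.* b → + a / b ≡ + c / d
/-cross a (suc b) c (suc d) eq = ℚ.fromℚᵘ-cong {mkℚᵘ (+ a) b} {mkℚᵘ (+ c) d}
  (*≡* (trans (sym (ℤ.pos-* a (suc d))) (trans (cong +_ eq) (ℤ.pos-* c (suc b)))))

/-*-/ : ∀ a b c d .{{_ : NonZero b}} .{{_ : NonZero d}} .{{_ : NonZero (b ℕ.* d)}} →
        (+ a / b) ℚ.* (+ c / d) ≡ + (a ℕ.* c) / (b ℕ.* d)
/-*-/ a (suc b) c (suc d) = ℚ.toℚᵘ-injective (begin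
  ℚ.toℚᵘ ((+ a / suc b) ℚ.* (+ c / suc d))
    ≈⟨ ℚ.toℚᵘ-homo-* (+ a / suc b) (+ c / suc d) ⟩
  ℚ.toℚᵘ (+ a / suc b) ℚᵘ.* ℚ.toℚᵘ (+ c / suc d)
    ≈⟨ ℚᵘ.*-cong (toℚᵘ-/ a b) (toℚᵘ-/ c d) ⟩
  mkℚᵘ (+ a ℤ.* + c) (d ℕ.+ b ℕ.* suc d)
    ≡⟨ cong (λ i → mkℚᵘ i (d ℕ.+ b ℕ.* suc d)) (sym (ℤ.pos-* a c)) ⟩
  mkℚᵘ (+ (a ℕ.* c)) (d ℕ.+ b ℕ.* suc d)
    ≈⟨ toℚᵘ-/ (a ℕ.* c) _ ⟨
  ℚ.toℚᵘ (+ (a ℕ.* c) / (suc b ℕ.* suc d)) ∎)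
  where open import Relation.Binary.Reasoning.Setoid ℚᵘ.≃-setoid

/-^ : ∀ a b k .{{_ : NonZero b}} .{{_ : NonZero (b ℕ.^ k)}} →
      (+ a / b) ^ k ≡ + (a ℕ.^ k) / (b ℕ.^ k)
/-^ a b zero    = refl
/-^ a b (suc k) =
  trans (cong ((+ a / b) ℚ.*_) (/-^ a b k)) (/-*-/ a b (a ℕ.^ k) (b ℕ.^ k))
  where instance _ = ℕ.m^n≢0 b k

/-mono-≤ : ∀ a b c d .{{_ : NonZero b}} .{{_ : NonZero d}} →
           a ℕ.* d ℕ.≤ c ℕ.* b → + a / b ℚ.≤ + c / d
/-mono-≤ a (suc b) c (suc d) le = ℚ.toℚᵘ-cancel-≤ (begin
  ℚ.toℚᵘ (+ a / suc b) ≃⟨ toℚᵘ-/ a b ⟩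
  mkℚᵘ (+ a) b         ≤⟨ *≤* (subst₂ ℤ._≤_ (ℤ.pos-* a (suc d)) (ℤ.pos-* c (suc b)) (ℤ.+≤+ le)) ⟩
  mkℚᵘ (+ c) d         ≃⟨ toℚᵘ-/ c d ⟨
  ℚ.toℚᵘ (+ c / suc d) ∎)
  where open ℚᵘ.≤-Reasoning

/-cancel-≤ : ∀ a b c d .{{_ : NonZero b}} .{{_ : NonZero d}} →
             + a / b ℚ.≤ + c / d → a ℕ.* d ℕ.≤ c ℕ.* b
/-cancel-≤ a (suc b) c (suc d) le = ℤ.drop‿+≤+
  (subst₂ ℤ._≤_ (sym (ℤ.pos-* a (suc d))) (sym (ℤ.pos-* c (suc b)))
    (ℚᵘ.drop-*≤* (begin
      mkℚᵘ (+ a) b         ≃⟨ toℚᵘ-/ a b ⟨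
      ℚ.toℚᵘ (+ a / suc b) ≤⟨ ℚ.toℚᵘ-mono-≤ le ⟩
      ℚ.toℚᵘ (+ c / suc d) ≃⟨ toℚᵘ-/ c d ⟩
      mkℚᵘ (+ c) d         ∎)))
  where open ℚᵘ.≤-Reasoning

-- Counting by bijections of setoids

FinS : ℕ → Setoid 0ℓ 0ℓ
FinS n = ≡.setoid (Fin n)

Maps : ℕ → ℕ → Setoid 0ℓ 0ℓ
Maps m n = Fin m →-setoid Fin n

-- Equality compares only the elements and ignores the proofs of `P`, so a predicate with several
-- proofs at one element does not inflate the size.
Sub : (S : Setoid 0ℓ 0ℓ) → Pred (Setoid.Carrier S) 0ℓ → Setoid 0ℓ 0ℓ
Sub S P = On.setoid {B = ∃ P} S proj₁

_HasSize_ : Setoid 0ℓ 0ℓ → ℕ → Set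
S HasSize n = Inverse S (FinS n)

mkInverse : let open Setoid S renaming (Carrier to A; _≈_ to _≈₁_)
                open Setoid T renaming (Carrier to B; _≈_ to _≈₂_) in
            (to : A → B) (from : B → A) →
            Congruent _≈₁_ _≈₂_ to → Congruent _≈₂_ _≈₁_ from →
            StrictlyInverseˡ _≈₂_ to from → StrictlyInverseʳ _≈₁_ to from →
            Inverse S T
mkInverse {S} {T} to from to-cong from-cong invˡ invʳ = record
  { to        = to
  ; from      = from
  ; to-cong   = to-cong
  ; from-cong = from-cong
  ; inverse   = (λ x≈ → Setoid.trans T (to-cong x≈) (invˡ _))
              , (λ y≈ → Setoid.trans S (from-cong y≈) (invʳ _))
  }

-- The composite is a bijection between `Fin m` and `Fin n`. Each equality of counts below is an
-- instance of this.
HasSize-cong : Inverse S T → S HasSize m → T HasSize n → m ≡ n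
HasSize-cong I s t =
  ↔⇒≡ (Composition.inverse (Symmetry.inverse s) (Composition.inverse I t))

pair-inverse : ∀ m n → Inverse (FinS (m ℕ.* n)) (FinS m ×ₛ FinS n)
pair-inverse m n = Composition.inverse (*↔× {m} {n}) (Symmetry.inverse Pointwise-≡↔≡)

×-HasSize : S HasSize m → T HasSize n → (S ×ₛ T) HasSize (m ℕ.* n)
×-HasSize s t =
  Composition.inverse (s ×-inverse t) (Symmetry.inverse (pair-inverse _ _))

module _ (I : Inverse S T) where
  open Inverse I
  private
    module S = Setoid S
    module T = Setoid T

  Sub-inverse : {P : Pred S.Carrier 0ℓ} {Q : Pred T.Carrier 0ℓ} →
                (∀ s → P s → Q (to s)) → (∀ t → Q t → P (from t)) →
                Inverse (Sub S P) (Sub T Q)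
  Sub-inverse f g = mkInverse
    (λ (s , p) → to s , f s p) (λ (t , q) → from t , g t q)
    to-cong from-cong (λ (t , _) → strictlyInverseˡ t) (λ (s , _) → strictlyInverseʳ s)

Sub-∩-inverse : {P Q : Pred (Setoid.Carrier S) 0ℓ} →
                Inverse (Sub S (P ∩ Q)) (Sub (Sub S P) (Q ∘ proj₁))
Sub-∩-inverse {S} = mkInverse
  (λ (s , p , q) → (s , p) , q) (λ ((s , p) , q) → s , p , q)
  id id (λ _ → S.refl) (λ _ → S.refl)
  where module S = Setoid S

Sub-proj₁-inverse : {P : Pred (Setoid.Carrier S) 0ℓ} →
                    Inverse (Sub (S ×ₛ T) (P ∘ proj₁)) (Sub S P ×ₛ T)
Sub-proj₁-inverse {S} {T} = mkInverse
  (λ ((s , t) , p) → (s , p) , t) (λ ((s , p) , t) → (s , t) , p)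
  id id (λ _ → Setoid.refl (S ×ₛ T)) (λ _ → Setoid.refl (S ×ₛ T))

Sub-×-inverse : {P : Pred (Setoid.Carrier S) 0ℓ} {Q : Pred (Setoid.Carrier T) 0ℓ} →
                Inverse (Sub (S ×ₛ T) (P ⟨×⟩ Q)) (Sub S P ×ₛ Sub T Q)
Sub-×-inverse {S} {T} = mkInverse
  (λ ((s , t) , p , q) → (s , p) , (t , q)) (λ ((s , p) , (t , q)) → (s , t) , p , q)
  id id (λ _ → Setoid.refl (S ×ₛ T)) (λ _ → Setoid.refl (S ×ₛ T))

module _ (S : Setoid 0ℓ 0ℓ) where
  open Setoid S using (_≈_) renaming (Carrier to A)

  lookup-injective : ∀ {xs} → Unique S xs → ∀ i j → lookup xs i ≈ lookup xs j → i ≡ j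
  lookup-injective (_ ∷ _)  zero    zero    _  = refl
  lookup-injective (x ∷ _)  zero    (suc j) eq = contradiction eq (All.lookup x (∈-lookup j))
  lookup-injective (x ∷ _)  (suc i) zero    eq = contradiction (Setoid.sym S eq) (All.lookup x (∈-lookup i))
  lookup-injective (_ ∷ xs) (suc i) (suc j) eq = cong suc (lookup-injective xs i j eq)

  module _ {P : Pred A 0ℓ} (P? : Decidable₁ P) (resp : P Respects _≈_)
           {xs : List A} (unique : Unique S xs) (enum : IsEnumeration S xs) where

    private
      ys = filter P? xs

      index : ∃ P → Fin (count P? xs)
      index (x , p) = Any.index (∈-filter⁺ S P? resp (enum x) p)

      lookup-index : ∀ x → lookup ys (index x) ≈ proj₁ x
      lookup-index (x , p) =
        Setoid.sym S (Any.lookup-index (∈-filter⁺ S P? resp (enum x) p))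

      injective : ∀ {i j} → lookup ys i ≈ lookup ys j → i ≡ j
      injective = lookup-injective (Unique.filter⁺ S P? unique) _ _

    -- An element corresponds to its position in the filtered list: enumeration provides a position,
    -- and uniqueness makes it the only one.
    count-HasSize : Sub S P HasSize count P? xs
    count-HasSize = mkInverse
      index (λ i → lookup ys i , All.lookup (all-filter P? xs) (∈-lookup i))
      (λ {x} {y} eq → injective
        (Setoid.trans S (lookup-index x) (Setoid.trans S eq (Setoid.sym S (lookup-index y)))))
      (λ { refl → Setoid.refl S })
      (λ i → injective (lookup-index _))
      lookup-index

funToFin-cong : {f g : Fin m → Fin n} → f ≗ g → funToFin f ≡ funToFin g
funToFin-cong {zero}  f≗g = refl
funToFin-cong {suc m} f≗g = cong₂ combine (f≗g zero) (funToFin-cong (f≗g ∘ suc))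

Maps-HasSize : ∀ m n → Maps m n HasSize (n ℕ.^ m)
Maps-HasSize m n = mkInverse funToFin finToFun funToFin-cong
  (λ { refl _ → refl }) (funToFin-finToFin {m} {n}) finToFun-funToFin

allFin-enumerates : ∀ n → IsEnumeration (FinS n) (allFin n)
allFin-enumerates n = ∈-allFin

-- The list `maps m n` is the image of `allFin` under the bijection `finToFun`, hence it inherits
-- uniqueness and completeness up to pointwise equality.
count-maps-HasSize : {P : Pred (Fin m → Fin n) 0ℓ} (P? : Decidable₁ P) →
                     P Respects _≗_ → Sub (Maps m n) P HasSize count P? (maps m n)
count-maps-HasSize {m} {n} P? resp = count-HasSize (Maps m n) P? resp
  (Unique.map⁺ (FinS _) (Maps m n) (Bijection.injective I) (allFin⁺ _))
  (Enumerates.map⁺ (FinS _) (Maps m n) (Bijection.surjection I) (allFin-enumerates _))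
  where I = Inverse⇒Bijection (Symmetry.inverse (Maps-HasSize m n))

-- Densities in directed graphs, loops and opposite arcs allowed

record Digraph : Set₁ where
  field
    v        : ℕ
    nonEmpty : NonZero v
    E        : Rel (Fin v) 0ℓ
    E?       : Decidable E

open OrientedGraph using (V; v; nonEmpty; E; E?; asym)

⌊_⌋ : OrientedGraph → Digraph
⌊ G ⌋ = record { OrientedGraph G }

homs : OrientedGraph → Digraph → ℕ
homs B D = count (isHom? (E? B) D.E?) (maps (v B) D.v)
  where module D = Digraph D

-- At `⌊ G ⌋` this unfolds to the same fraction as `t B G`, so results on digraphs apply to oriented
-- graphs without conversion.
density : OrientedGraph → Digraph → ℚ
density B D = + homs B D / (Digraph.v D ℕ.^ v B)
  where instance
  _ = Digraph.nonEmpty D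
  _ = ℕ.m^n≢0 (Digraph.v D) (v B)

IsHom-resp : {R : Rel (Fin m) 0ℓ} {S : Rel (Fin n) 0ℓ} → IsHom R S Respects _≗_
IsHom-resp {S = S} f≗g hom x y r = subst₂ S (f≗g x) (f≗g y) (hom x y r)

Homs : OrientedGraph → Digraph → Setoid 0ℓ 0ℓ
Homs B D = Sub (Maps (v B) (Digraph.v D)) (IsHom (E B) (Digraph.E D))

Homs-HasSize : ∀ B D → Homs B D HasSize homs B D
Homs-HasSize B D =
  count-maps-HasSize (isHom? (E? B) (Digraph.E? D)) (IsHom-resp {S = Digraph.E D})

-- Tensor powers

infixr 7 _⊗_

-- The tensor product. Asymmetry of the second factor alone makes the product oriented, so a factor
-- `K⃗₂` orients an arbitrary digraph.
_⊗_ : Digraph → OrientedGraph → OrientedGraph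
D ⊗ G = record
  { v        = D.v ℕ.* G.v
  ; nonEmpty = ℕ.m*n≢0 D.v G.v
  ; E        = λ p q → D.E (quotient G.v p) (quotient G.v q)
                     × G.E (remainder {D.v} G.v p) (remainder {D.v} G.v q)
  ; E?       = λ p q → D.E? _ _ ×-dec G.E? _ _
  ; asym     = λ (_ , p) (_ , q) → G.asym p q
  }
  where
  module D = Digraph D
  module G = OrientedGraph G
  instance
    _ = D.nonEmpty
    _ = G.nonEmpty

maps-pair-inverse : ∀ k m n → Inverse (Maps k (m ℕ.* n)) (Maps k m ×ₛ Maps k n)
maps-pair-inverse k m n = mkInverse
  (λ f → quotient n ∘ f , remainder {m} n ∘ f)
  (λ (g , h) x → combine (g x) (h x))
  (λ eq → (λ x → cong (quotient n) (eq x)) , (λ x → cong (remainder {m} n) (eq x)))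
  (λ (eq₁ , eq₂) x → cong₂ combine (eq₁ x) (eq₂ x))
  (λ (g , h) → (λ x → cong proj₁ (remQuot-combine (g x) (h x)))
             , (λ x → cong proj₂ (remQuot-combine (g x) (h x))))
  (λ f x → combine-remQuot {m} n (f x))

-- A map into the product is a pair of maps, and it is a homomorphism exactly when both components
-- are.
homs-⊗ : ∀ B D G → homs B ⌊ D ⊗ G ⌋ ≡ homs B D ℕ.* homs B ⌊ G ⌋
homs-⊗ B D G = HasSize-cong
  (Composition.inverse
    (Sub-inverse (maps-pair-inverse (v B) D.v (v G))
      (λ f h → (λ x y r → proj₁ (h x y r)) , (λ x y r → proj₂ (h x y r)))
      (λ (f , g) (h , k) x y r →
         subst₂ D.E (sym (cong proj₁ (remQuot-combine (f x) (g x))))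
                    (sym (cong proj₁ (remQuot-combine (f y) (g y)))) (h x y r)
       , subst₂ (E G) (sym (cong proj₂ (remQuot-combine (f x) (g x))))
                      (sym (cong proj₂ (remQuot-combine (f y) (g y)))) (k x y r)))
    Sub-×-inverse)
  (Homs-HasSize B ⌊ D ⊗ G ⌋)
  (×-HasSize (Homs-HasSize B D) (Homs-HasSize B ⌊ G ⌋))
  where module D = Digraph D

-- The tensor power trick

module _ (B : OrientedGraph) (sidorenko : DirectedSidorenko B) (D : Digraph) where
  private
    module D = Digraph D
    instance
      _ = D.nonEmpty
      _ = ℕ.m^n≢0 D.v (v B)
      _ = ℕ.m^n≢0 D.v 2
      _ = ℕ.m^n≢0 (D.v ℕ.^ 2) (e B)

    -- The sides of the cross-multiplied inequality t(B,G) ≥ t(K⃗₂,G)^e(B).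
    smaller larger : Digraph → ℕ
    smaller G = homs K⃗₂ G ℕ.^ e B ℕ.* Digraph.v G ℕ.^ v B
    larger  G = homs B G ℕ.* (Digraph.v G ℕ.^ 2) ℕ.^ e B

    smaller-⊗ : ∀ G → smaller ⌊ D ⊗ G ⌋ ≡ smaller D ℕ.* smaller ⌊ G ⌋
    smaller-⊗ G = trans
      (cong₂ ℕ._*_
        (trans (cong (ℕ._^ e B) (homs-⊗ K⃗₂ D G)) (^-distribʳ-* _ _ (e B)))
        (^-distribʳ-* D.v (v G) (v B)))
      (interchange (homs K⃗₂ D ℕ.^ e B) _ _ _)

    larger-⊗ : ∀ G → larger ⌊ D ⊗ G ⌋ ≡ larger D ℕ.* larger ⌊ G ⌋
    larger-⊗ G = trans
      (cong₂ ℕ._*_ (homs-⊗ B D G)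
        (trans (cong (ℕ._^ e B) (^-distribʳ-* D.v (v G) 2)) (^-distribʳ-* (D.v ℕ.^ 2) _ (e B))))
      (interchange (homs B D) _ _ _)

    -- Starting from `K⃗₂` keeps every power oriented, within reach of the hypothesis on `B`.
    power : ℕ → OrientedGraph
    power zero    = K⃗₂
    power (suc k) = D ⊗ power k

    multiplicative-power : (c : Digraph → ℕ) →
      (∀ G → c ⌊ D ⊗ G ⌋ ≡ c D ℕ.* c ⌊ G ⌋) →
      ∀ k → c ⌊ power k ⌋ ≡ c D ℕ.^ k ℕ.* c ⌊ K⃗₂ ⌋
    multiplicative-power c c-⊗ zero    = sym (ℕ.*-identityˡ _)
    multiplicative-power c c-⊗ (suc k) = trans (c-⊗ (power k))
      (trans (cong (c D ℕ.*_) (multiplicative-power c c-⊗ k)) (sym (ℕ.*-assoc (c D) _ _)))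

    smaller≤larger : ∀ G → smaller ⌊ G ⌋ ℕ.≤ larger ⌊ G ⌋
    smaller≤larger G =
      /-cancel-≤ (homs K⃗₂ ⌊ G ⌋ ℕ.^ e B) ((v G ℕ.^ 2) ℕ.^ e B) (homs B ⌊ G ⌋) (v G ℕ.^ v B)
        (subst (ℚ._≤ t B G) (/-^ (homs K⃗₂ ⌊ G ⌋) (v G ℕ.^ 2) (e B)) (sidorenko G))
      where instance
        _ = nonEmpty G
        _ = ℕ.m^n≢0 (v G) (v B)
        _ = ℕ.m^n≢0 (v G) 2
        _ = ℕ.m^n≢0 (v G ℕ.^ 2) (e B)

    smaller-K⃗₂≢0 : NonZero (smaller ⌊ K⃗₂ ⌋)
    -- The base 1 is the value of `homs K⃗₂ ⌊ K⃗₂ ⌋`, the identity being the only homomorphism.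
    smaller-K⃗₂≢0 = ℕ.m*n≢0 (1 ℕ.^ e B) (2 ℕ.^ v B)
      where instance
        _ = ℕ.m^n≢0 1 (e B)
        _ = ℕ.m^n≢0 2 (v B)

  -- Orienting D costs a constant factor, which the k-th tensor power D^k ⊗ K⃗₂
  -- makes negligible as k grows.
  DirectedSidorenko-digraph : density B D ≥ density K⃗₂ D ^ e B
  DirectedSidorenko-digraph =
    subst (ℚ._≤ density B D) (sym (/-^ (homs K⃗₂ D) (D.v ℕ.^ 2) (e B)))
      (/-mono-≤ (homs K⃗₂ D ℕ.^ e B) ((D.v ℕ.^ 2) ℕ.^ e B) (homs B D) (D.v ℕ.^ v B)
        (powers-cancel-≤ λ k →
          subst₂ ℕ._≤_ (multiplicative-power smaller smaller-⊗ k)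
                       (multiplicative-power larger larger-⊗ k)
                       (smaller≤larger (power k))))
    where instance _ = smaller-K⃗₂≢0

-- Densities in bipartite graphs

module _ (B : OrientedGraph) (φ : V B → V K⃗₂) (hom : Hom B K⃗₂ φ) where
  private
    A = underlying B φ hom
    module A = BipartiteGraph A

  -- By asymmetry each undirected edge carries exactly one arc. `orient` passes from the increasing
  -- pair of endpoints to that arc, and `increase` sorts the endpoints again.
  eBip-underlying : eBip A ≡ e B
  eBip-underlying = HasSize-cong
    (mkInverse
      (λ { ((x , y) , x<y , p) → orient x y , orient-E x y p })
      (λ { ((x , y) , p) → increase x y , increase-< x y p })
      (λ { {_ , _} {_ , _} (refl , refl) → refl , refl })
      (λ { {_ , _} {_ , _} (refl , refl) → refl , refl })
      (λ { ((x , y) , p) → orient-increase x y p })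
      (λ { ((x , y) , x<y , p) → increase-orient x y x<y p }))
    (pairs-HasSize _) (pairs-HasSize _)
    where
    pairs-HasSize : {P : Pred (V B × V B) 0ℓ} (P? : Decidable₁ P) →
                    Sub (FinS (v B) ×ₛ FinS (v B)) P HasSize count P? (pairs (v B))
    pairs-HasSize P? = count-HasSize (FinS _ ×ₛ FinS _) P? (λ { (refl , refl) p → p })
      (Unique.cartesianProduct⁺ (FinS _) (FinS _) (allFin⁺ _) (allFin⁺ _))
      (Enumerates.cartesianProduct⁺ (FinS _) (FinS _) (allFin-enumerates _) (allFin-enumerates _))

    orient increase : V B → V B → V B × V B
    orient x y with E? B x y
    ... | yes _ = x , y
    ... | no  _ = y , x
    increase x y with x <? y
    ... | yes _ = x , y
    ... | no  _ = y , x

    orient-E : ∀ x y → A.E x y → E B (proj₁ (orient x y)) (proj₂ (orient x y))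
    orient-E x y p with E? B x y | p
    ... | yes q | _      = q
    ... | no ¬q | inj₁ q = contradiction q ¬q
    ... | no ¬q | inj₂ q = q

    ≮⇒> : ∀ {x y} → E B x y → ¬ x < y → y < x
    ≮⇒> {x} {y} p x≮y with <-cmp x y
    ... | tri< x<y _ _  = contradiction x<y x≮y
    ... | tri≈ _ refl _ = contradiction p (asym B p)
    ... | tri> _ _ y<x  = y<x

    increase-< : ∀ x y → E B x y →
                 let (x′ , y′) = increase x y in x′ < y′ × A.E x′ y′
    increase-< x y p with x <? y
    ... | yes x<y = x<y , inj₁ p
    ... | no  x≮y = ≮⇒> p x≮y , inj₂ p

    _≈_ : Rel (V B × V B) 0ℓ
    _≈_ = Setoid._≈_ (FinS (v B) ×ₛ FinS (v B))

    orient-increase : ∀ x y → E B x y →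
                      let (x′ , y′) = increase x y in orient x′ y′ ≈ (x , y)
    orient-increase x y p with x <? y
    orient-increase x y p | yes _ with E? B x y
    ... | yes _ = refl , refl
    ... | no ¬p = contradiction p ¬p
    orient-increase x y p | no _ with E? B y x
    ... | yes q = contradiction q (asym B p)
    ... | no  _ = refl , refl

    increase-orient : ∀ x y → x < y → A.E x y →
                      let (x′ , y′) = orient x y in increase x′ y′ ≈ (x , y)
    increase-orient x y x<y p with E? B x y
    increase-orient x y x<y p | yes _ with x <? y
    ... | yes _   = refl , refl
    ... | no  x≮y = contradiction x<y x≮y
    increase-orient x y x<y p | no _ with y <? x
    ... | yes y<x = contradiction x<y (<-asym y<x)
    ... | no  _   = refl , refl

  module _ (H : BipartiteGraph) where
    private module H = BipartiteGraph H

    BipHom : Pred (V B → Fin H.v) 0ℓ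
    BipHom = PartPreserving A H ∩ IsHom A.E H.E

    PartPreserving-resp : PartPreserving A H Respects _≗_
    PartPreserving-resp f≗g pp x = trans (cong H.part (sym (f≗g x))) (pp x)

    partPreserving-HasSize :
      Sub (Maps (v B) H.v) (PartPreserving A H) HasSize #partPreserving A H
    partPreserving-HasSize =
      count-maps-HasSize (partPreserving? A H) PartPreserving-resp

    bipHom? : Decidable₁ BipHom
    bipHom? f = partPreserving? A H f ×-dec isHom? A.E? H.E? f

    #bipHom : ℕ
    #bipHom = count bipHom? (maps (v B) H.v)

    bipHom-HasSize : Sub (Maps (v B) H.v) BipHom HasSize #bipHom
    bipHom-HasSize = count-maps-HasSize bipHom?
      (λ f≗g (pp , h) → PartPreserving-resp f≗g pp , IsHom-resp {S = H.E} f≗g h)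

  -- Symmetry of `S` leaves only the arcs of `B` to check, and `hom` places their tails in the first
  -- part and their heads in the second.
  IsHom-underlying : ∀ {n} {S : Rel (Fin n) 0ℓ} → (∀ {p q} → S p q → S q p) →
                     {f : V B → Fin n} →
                     (∀ x y → φ x ≡ 0F → φ y ≡ 1F → E B x y → S (f x) (f y)) →
                     IsHom A.E S f
  IsHom-underlying symm h x y (inj₁ p) = let (a , b) = hom x y p in h x y a b p
  IsHom-underlying symm h x y (inj₂ p) = let (a , b) = hom y x p in symm (h y x a b p)

-- From digraphs to bipartite graphs

module _ (D : Digraph) where
  private
    module D = Digraph D

    side : Fin (D.v ℕ.* 2) → Fin 2
    side = remainder {D.v} 2

    base : Fin (D.v ℕ.* 2) → Fin D.v
    base = quotient 2

  -- Each arc from `p` to `q` becomes an edge between `(p , 0F)` and `(q , 1F)`.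
  doubleCover : BipartiteGraph
  doubleCover = underlying (D ⊗ K⃗₂) side (λ _ _ → proj₂)

  private module H = BipartiteGraph doubleCover

  doubleCover-nonEmptyParts : NonEmptyParts doubleCover
  doubleCover-nonEmptyParts i =
    combine (vertex D.v D.nonEmpty) i , cong proj₂ (remQuot-combine {D.v} _ i)
    where
    vertex : ∀ n → .(NonZero n) → Fin n
    vertex (suc n) _ = zero

  module _ (B : OrientedGraph) (φ : V B → V K⃗₂) (hom : Hom B K⃗₂ φ) where
    private
      A = underlying B φ hom
      module A = BipartiteGraph A

      base-combine : ∀ (g : V B → Fin D.v) x → base (combine (g x) (φ x)) ≡ g x
      base-combine g x = cong proj₁ (remQuot-combine (g x) (φ x))

      side-combine : ∀ (g : V B → Fin D.v) x → side (combine (g x) (φ x)) ≡ φ x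
      side-combine g x = cong proj₂ (remQuot-combine (g x) (φ x))

    -- The side of each image is forced to be `φ x`, so only the base vertex is free.
    partPreserving-inverse :
      Inverse (Sub (Maps (v B) H.v) (PartPreserving A doubleCover)) (Maps (v B) D.v)
    partPreserving-inverse = mkInverse
      (λ (f , _) → base ∘ f)
      (λ g → (λ x → combine (g x) (φ x)) , side-combine g)
      (λ eq x → cong base (eq x))
      (λ eq x → cong (λ i → combine i (φ x)) (eq x))
      base-combine
      (λ (f , pp) x → trans (cong (combine (base (f x))) (sym (pp x)))
                            (combine-remQuot {D.v} 2 (f x)))

    bipHom-inverse : Inverse (Sub (Maps (v B) H.v) (BipHom B φ hom doubleCover)) (Homs B D)
    bipHom-inverse = Composition.inverse Sub-∩-inverse
      (Sub-inverse partPreserving-inverse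
        (λ (f , pp) h x y p → base-hom f pp x y p (h x y (inj₁ p)))
        (λ g h → IsHom-underlying B φ hom {S = H.E} H.symmetric λ x y φx≡0 φy≡1 p → inj₁
          ( subst₂ D.E (sym (base-combine g x)) (sym (base-combine g y)) (h x y p)
          , trans (side-combine g x) φx≡0
          , trans (side-combine g y) φy≡1)))
      where
      base-hom : ∀ f → PartPreserving A doubleCover f → ∀ x y → E B x y →
                 H.E (f x) (f y) → D.E (base (f x)) (base (f y))
      base-hom f pp x y p (inj₁ (q , _))         = q
      -- The reversed arc would put `f x` on side `1F`, but `x` is the tail of an arc and so `φ x`
      -- is `0F`.
      base-hom f pp x y p (inj₂ (_ , _ , side≡1)) =
        contradiction (trans (sym (proj₁ (hom x y p))) (trans (sym (pp x)) side≡1)) λ ()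

    tBip-doubleCover : tBip A doubleCover doubleCover-nonEmptyParts ≡ density B D
    tBip-doubleCover = ℚ./-cong
      (cong +_ (HasSize-cong bipHom-inverse
        (bipHom-HasSize B φ hom doubleCover) (Homs-HasSize B D)))
      (HasSize-cong partPreserving-inverse
        (partPreserving-HasSize B φ hom doubleCover) (Maps-HasSize (v B) D.v))
      where instance
        _ = #partPreserving≢0 A doubleCover doubleCover-nonEmptyParts
        _ = D.nonEmpty
        _ = ℕ.m^n≢0 D.v (v B)

-- From bipartite graphs to digraphs

module _ (H : BipartiteGraph) (ne : NonEmptyParts H) where
  private
    module H = BipartiteGraph H

    Part : Fin 2 → Setoid 0ℓ 0ℓ
    Part i = Sub (FinS H.v) (λ u → H.part u ≡ i)

    size : Fin 2 → ℕ
    size i = count (λ u → H.part u ≟ i) (allFin H.v)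

    Part-HasSize : ∀ i → Part i HasSize size i
    Part-HasSize i = count-HasSize (FinS H.v) _ (λ { refl p → p })
      (allFin⁺ H.v) (allFin-enumerates H.v)

    size≢0 : ∀ i → NonZero (size i)
    size≢0 i = Fin⇒NonZero (Inverse.to (Part-HasSize i) (ne i))
      where
      Fin⇒NonZero : Fin n → NonZero n
      Fin⇒NonZero zero    = _
      Fin⇒NonZero (suc _) = _

    N : ℕ
    N = size 0F ℕ.* size 1F

    -- The index selects which coordinate of a vertex of U₁ × U₂ comes first; at `x` it will be the
    -- one in the part `φ x`.
    vertex-inverse : ∀ i → Inverse (FinS N) (Part i ×ₛ Part (opposite i))
    vertex-inverse 0F = Composition.inverse (pair-inverse (size 0F) (size 1F))
      (Symmetry.inverse (Part-HasSize 0F) ×-inverse Symmetry.inverse (Part-HasSize 1F))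
    vertex-inverse 1F = Composition.inverse (vertex-inverse 0F)
      (mkInverse swap swap swap swap (λ _ → refl , refl) (λ _ → refl , refl))

    module J i = Inverse (vertex-inverse i)

    coord : Fin 2 → Fin N → Fin H.v
    coord i p = proj₁ (proj₁ (J.to i p))

  -- On U₁ × U₂, an arc (u₁, u₂) → (w₁, w₂) for each edge u₁ ~ w₂.  The coordinate
  -- of a vertex in the part opposite to φ x is left free by homomorphisms, which
  -- is the factor r below.
  partProduct : Digraph
  partProduct = record
    { v        = N
    ; nonEmpty = ℕ.m*n≢0 (size 0F) (size 1F)
    ; E        = λ p q → H.E (coord 0F p) (coord 1F q)
    ; E?       = λ p q → H.E? _ _
    }
    where instance
      _ = size≢0 0F
      _ = size≢0 1F

  module _ (B : OrientedGraph) (φ : V B → V K⃗₂) (hom : Hom B K⃗₂ φ) where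
    private
      A = underlying B φ hom

      PartReversing : Pred (V B → Fin H.v) 0ℓ
      PartReversing f = ∀ x → H.part (f x) ≡ opposite (φ x)

      partReversing? : Decidable₁ PartReversing
      partReversing? f = all? λ x → H.part (f x) ≟ opposite (φ x)

      r : ℕ
      r = count partReversing? (maps (v B) H.v)

      partReversing-HasSize : Sub (Maps (v B) H.v) PartReversing HasSize r
      partReversing-HasSize = count-maps-HasSize partReversing?
        (λ f≗g p x → trans (cong H.part (sym (f≗g x))) (p x))

      -- At each `x` the coordinate in the part `φ x` goes to the part-preserving map and the other
      -- coordinate to the part-reversing map.
      maps-inverse : Inverse (Maps (v B) N)
        (Sub (Maps (v B) H.v) (PartPreserving A H) ×ₛ Sub (Maps (v B) H.v) PartReversing)
      maps-inverse = mkInverse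
        (λ f → ( (λ x → proj₁ (proj₁ (J.to (φ x) (f x))))
               , (λ x → proj₂ (proj₁ (J.to (φ x) (f x)))))
             , ( (λ x → proj₁ (proj₂ (J.to (φ x) (f x))))
               , (λ x → proj₂ (proj₂ (J.to (φ x) (f x))))))
        (λ ((g , p) , (h , q)) x → J.from (φ x) ((g x , p x) , (h x , q x)))
        (λ eq → (λ x → proj₁ (J.to-cong (φ x) (eq x)))
              , (λ x → proj₂ (J.to-cong (φ x) (eq x))))
        (λ (eq₁ , eq₂) x → J.from-cong (φ x) (eq₁ x , eq₂ x))
        (λ ((g , p) , (h , q)) →
            (λ x → proj₁ (J.strictlyInverseˡ (φ x) ((g x , p x) , (h x , q x))))
          , (λ x → proj₂ (J.strictlyInverseˡ (φ x) ((g x , p x) , (h x , q x)))))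
        (λ f x → J.strictlyInverseʳ (φ x) (f x))

      -- An arc of `B` goes from part `0F` to part `1F`, and an arc of `partProduct` tests the first
      -- coordinate of its tail and the second of its head. These are the coordinates selected by
      -- `φ`, so the condition falls on the part-preserving map alone.
      homs-inverse : Inverse (Homs B partProduct)
        (Sub (Maps (v B) H.v) (BipHom B φ hom H) ×ₛ Sub (Maps (v B) H.v) PartReversing)
      homs-inverse = Composition.inverse
        (Sub-inverse maps-inverse
          (λ f h → IsHom-underlying B φ hom {S = H.E} H.symmetric λ x y φx≡0 φy≡1 p →
            subst₂ (λ i j → H.E (coord i (f x)) (coord j (f y)))
                   (sym φx≡0) (sym φy≡1) (h x y p))
          (λ { t@((g , pp) , (g′ , pr)) h x y p →
            let (φx≡0 , φy≡1) = hom x y p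
                f = Inverse.from maps-inverse t
                coord-f : ∀ x → coord (φ x) (f x) ≡ g x
                coord-f = proj₁ (Inverse.strictlyInverseˡ maps-inverse t)
            in subst₂ (λ i j → H.E (coord i (f x)) (coord j (f y))) φx≡0 φy≡1
                 (subst₂ H.E (sym (coord-f x)) (sym (coord-f y)) (h x y (inj₁ p))) }))
        (Composition.inverse Sub-proj₁-inverse
          (Symmetry.inverse Sub-∩-inverse ×-inverse Identity.inverse _))

      homs≡ : homs B partProduct ≡ #bipHom B φ hom H ℕ.* r
      homs≡ = HasSize-cong homs-inverse (Homs-HasSize B partProduct)
        (×-HasSize (bipHom-HasSize B φ hom H) partReversing-HasSize)

      maps≡ : N ℕ.^ v B ≡ #partPreserving A H ℕ.* r
      maps≡ = HasSize-cong maps-inverse (Maps-HasSize (v B) N)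
        (×-HasSize (partPreserving-HasSize B φ hom H) partReversing-HasSize)

    -- Passing to `partProduct` multiplies both the number of homomorphisms and the number of maps
    -- by `r`, so the ratio is unchanged.
    tBip-partProduct : tBip A H ne ≡ density B partProduct
    tBip-partProduct = /-cross (#bipHom B φ hom H) (#partPreserving A H) (homs B partProduct) (N ℕ.^ v B)
      (begin
        #bipHom B φ hom H ℕ.* N ℕ.^ v B
          ≡⟨ cong (#bipHom B φ hom H ℕ.*_) (trans maps≡ (ℕ.*-comm (#partPreserving A H) r)) ⟩
        #bipHom B φ hom H ℕ.* (r ℕ.* #partPreserving A H)
          ≡⟨ ℕ.*-assoc (#bipHom B φ hom H) r _ ⟨
        #bipHom B φ hom H ℕ.* r ℕ.* #partPreserving A H
          ≡⟨ cong (ℕ._* #partPreserving A H) homs≡ ⟨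
        homs B partProduct ℕ.* #partPreserving A H ∎)
      where
      open ≡-Reasoning
      instance
        _ = #partPreserving≢0 A H ne
        _ = Digraph.nonEmpty partProduct
        _ = ℕ.m^n≢0 N (v B)

theorem1p5 : (B : OrientedGraph) (f : OrientedGraph.V B → OrientedGraph.V K⃗₂)
    (hom : Hom B K⃗₂ f) →
    AsymmetricSidorenko (underlying B f hom) ⇔ DirectedSidorenko B
theorem1p5 B f hom = mk⇔
  (λ asymmetric G → subst₂ _≥_
    (tBip-doubleCover ⌊ G ⌋ B f hom)
    -- `K₂` is by definition the underlying graph of `K⃗₂`, so the edge densities are compared by
    -- the same lemma.
    (cong₂ _^_ (tBip-doubleCover ⌊ G ⌋ K⃗₂ id (λ _ _ → id)) (eBip-underlying B f hom))
    (asymmetric (doubleCover ⌊ G ⌋) (doubleCover-nonEmptyParts ⌊ G ⌋)))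
  (λ directed H ne → subst₂ _≥_
    (sym (tBip-partProduct H ne B f hom))
    (sym (cong₂ _^_ (tBip-partProduct H ne K⃗₂ id (λ _ _ → id)) (eBip-underlying B f hom)))
    (DirectedSidorenko-digraph B directed (partProduct H ne)))
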